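{- Let $G$ be a finite simple graph with $q$ edges. (Sufficiency) Suppose that $q$ is even and that $G$ has $\frac{q}{2}$ mutually disjoint $\langle xyz\rangle$ paths such that no cycle of $G$ contains an odd number of these paths. Then the line graph $L(G)$ is a 2-variegated graph. (Converse) If $L(G)$ is a 2-variegated graph with $2n$ vertices, then $G$ has $n$ mutually disjoint $\langle xyz\rangle$ paths such that no cycle of $G$ contains an odd number of these paths.
   Context: All graphs are finite, without loops or multiple edges. A graph $B$ with $2n$ vertices is 2-variegated (bivariegated) if its vertex set can be partitioned into two parts of equal size $n$ such that each vertex of either part is adjacent to exactly one vertex of the other part (adjacencies inside a part are unrestricted). The line graph $L(G)$ has the edges of $G$ as vertices, two of them being adjacent in $L(G)$ if and only if the corresponding edges of $G$ share an endpoint. An $\langle xyz\rangle$ path in $G$ is a path of length 2 with edges $xy$ and $yz$ on three distinct vertices $x,y,z$ that is an induced subgraph of $G$ (so $x$ and $z$ are not adjacent in $G$) and whose middle vertex $y$ has degree exactly $2$ in $G$. Two paths are disjoint if they have no common edge. A cycle contains (a path lies on a cycle) an $\langle xyz\rangle$ path if both edges of the path are edges of the cycle. -}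

module Defs where

open import Level using (0ℓ)
open import Data.Nat using (ℕ; _*_; _≤_; _%_)
open import Data.Fin using (Fin; _<_; _≟_; _<?_)
open import Data.Fin.Properties using (any?)
open import Data.Fin.Subset using (Subset; _∈_; ∁; ∣_∣)
open import Data.List using (List; []; _∷_; _∷ʳ_; allFin; cartesianProduct; filter; length; lookup; zip)
open import Data.List.Relation.Unary.All using (All; all?)
open import Data.List.Relation.Unary.Any as Any using (Any)
open import Data.List.Relation.Unary.Unique.Propositional using (Unique)
open import Data.Product using (Σ-syntax; ∃-syntax; ∃!; _×_; _,_; swap; uncurry)
open import Data.Sum using (_⊎_)
open import Relation.Binary using (Rel; Symmetric; Irreflexive; Decidable)
open import Relation.Binary.PropositionalEquality using (_≡_; _≢_; sym)
open import Relation.Nullary using (¬_; Dec)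
open import Relation.Nullary.Decidable using (_×-dec_; _⊎-dec_; ¬?)

record Graph : Set₁ where
  field
    order      : ℕ
    Adj        : Rel (Fin order) 0ℓ
    adj?       : Decidable Adj
    adj-sym    : Symmetric Adj
    adj-irrefl : Irreflexive _≡_ Adj

  Vertex : Set
  Vertex = Fin order

  degree : Vertex → ℕ
  degree v = length (filter (adj? v) (allFin order))

  -- Every edge is listed once, with its smaller endpoint first.
  edges : List (Vertex × Vertex)
  edges = filter (λ (u , v) → (u <? v) ×-dec adj? u v)
                 (cartesianProduct (allFin order) (allFin order))

  size : ℕ
  size = length edges

open Graph public using (Vertex; order; size)

module _ {n : ℕ} where

  IsEndpoint : Fin n → Fin n × Fin n → Set
  IsEndpoint w (u , v) = w ≡ u ⊎ w ≡ v

  isEndpoint? : Decidable IsEndpoint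
  isEndpoint? w (u , v) = (w ≟ u) ⊎-dec (w ≟ v)

  ShareEndpoint : Rel (Fin n × Fin n) 0ℓ
  ShareEndpoint e f = ∃[ w ] IsEndpoint w e × IsEndpoint w f

  shareEndpoint? : Decidable ShareEndpoint
  shareEndpoint? e f = any? (λ w → isEndpoint? w e ×-dec isEndpoint? w f)

  -- Equality of the unordered pairs {u , v} and {x , y}.
  _≐_ : Rel (Fin n × Fin n) 0ℓ
  (u , v) ≐ (x , y) = (u ≡ x × v ≡ y) ⊎ (u ≡ y × v ≡ x)

  _≐?_ : Decidable _≐_
  (u , v) ≐? (x , y) = ((u ≟ x) ×-dec (v ≟ y)) ⊎-dec ((u ≟ y) ×-dec (v ≟ x))

  _∈ᵉ_ : Fin n × Fin n → List (Fin n × Fin n) → Set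
  e ∈ᵉ es = Any (e ≐_) es

  _∈ᵉ?_ : Decidable _∈ᵉ_
  e ∈ᵉ? es = Any.any? (e ≐?_) es

-- Vertices of the line graph are positions in the list of edges.
lineGraph : Graph → Graph
lineGraph G = record
  { order      = size G
  ; Adj        = λ i j → i ≢ j × ShareEndpoint (lookup edges i) (lookup edges j)
  ; adj?       = λ i j → ¬? (i ≟ j) ×-dec shareEndpoint? (lookup edges i) (lookup edges j)
  ; adj-sym    = λ (i≢j , w , p) → (λ j≡i → i≢j (sym j≡i)) , w , swap p
  ; adj-irrefl = λ i≡j (i≢j , _) → i≢j i≡j
  }
  where open Graph G using (edges)

Bivariegated : Graph → Set
Bivariegated B =
  ∃[ n ] order B ≡ 2 * n ×
  (Σ[ S ∈ Subset (order B) ]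
    ∣ S ∣ ≡ n × ∣ ∁ S ∣ ≡ n ×
    (∀ v → v ∈ S → ∃! _≡_ (λ w → w ∈ ∁ S × Adj v w)) ×
    (∀ v → v ∈ ∁ S → ∃! _≡_ (λ w → w ∈ S × Adj v w)))
  where open Graph B using (Adj)

record XYZPath (G : Graph) : Set where
  open Graph G using (Adj; degree)
  field
    x y z    : Vertex G
    x≢y      : x ≢ y
    y≢z      : y ≢ z
    x≢z      : x ≢ z
    adj-xy   : Adj x y
    adj-yz   : Adj y z
    induced  : ¬ Adj x z
    degree-y : degree y ≡ 2

  pathEdges : List (Vertex G × Vertex G)
  pathEdges = (x , y) ∷ (y , z) ∷ []

open XYZPath public using (pathEdges)

-- The cycle base – v₁ – … – vₖ – base, where others = v₁ ∷ … ∷ vₖ ∷ [].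
record Cycle (G : Graph) : Set where
  field
    base   : Vertex G
    others : List (Vertex G)

  cycleEdges : List (Vertex G × Vertex G)
  cycleEdges = zip (base ∷ others) (others ∷ʳ base)

  field
    length≥3 : 3 ≤ length (base ∷ others)
    distinct : Unique (base ∷ others)
    adjacent : All (uncurry (Graph.Adj G)) cycleEdges

open Cycle public using (cycleEdges)

module _ {G : Graph} where

  Disjoint : Rel (XYZPath G) 0ℓ
  Disjoint p q = ¬ (∃[ e ] e ∈ᵉ pathEdges p × e ∈ᵉ pathEdges q)

  Contains : Cycle G → XYZPath G → Set
  Contains c p = All (_∈ᵉ cycleEdges c) (pathEdges p)

  contains? : Decidable Contains
  contains? c p = all? (_∈ᵉ? cycleEdges c) (pathEdges p)

  numContained : ∀ {k} → Cycle G → (Fin k → XYZPath G) → ℕ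
  numContained {k} c P = length (filter (λ i → contains? c (P i)) (allFin k))

Odd : ℕ → Set
Odd m = m % 2 ≡ 1

HasPathSystem : Graph → ℕ → Set
HasPathSystem G k =
  Σ[ P ∈ (Fin k → XYZPath G) ]
    (∀ i j → i ≢ j → Disjoint (P i) (P j)) ×
    ¬ (∃[ c ] Odd (numContained c P))

{-# OPTIONS --safe #-}
-- A system of disjoint ⟨xyz⟩ paths signs the edges of G: xy gets sign 1 for each path and every other edge sign 0.
-- Because y has degree two, a cycle through xy also runs through yz, so the parity of the number of paths on a
-- cycle is the sum of the signs along it.  By Harary's theorem no cycle is odd if and only if the signing comes
-- from a potential Vertex G → Bool, whose value changes exactly along the edges xy.
--
-- If the paths cover all edges, colouring xy by the potential of x and yz by the potential of z makes the two edges
-- of each path differ and edges meeting anywhere other than at a middle vertex agree: a bivariegation of L(G).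
-- Conversely, in a bivariegation each edge xy of S meets exactly one edge yz outside S, and "v is incident with an
-- edge outside S" is a potential for the resulting paths.
module Submission where

open import Algebra.Bundles using (CommutativeRing; CommutativeMonoid)
open import Algebra.Properties.CommutativeSemigroup using (interchange)
open import Data.Bool using (Bool; true; false; not; _xor_; if_then_else_)
open import Data.Bool.Properties using (xor-assoc; xor-comm; xor-same; xor-identityʳ; not-involutive; ¬-not; not-¬; xor-∧-commutativeRing)
open import Data.Fin using (Fin; zero; suc; combine; remQuot; _≟_) renaming (_<_ to _<ᶠ_)
open import Data.Fin.Properties using (any?; combine-remQuot; injective⇒≤; suc-injective; <-asym; <-cmp)
open import Data.Fin.Subset using (Subset; ∁; ∣_∣) renaming (_∈_ to _∈ˢ_)
open import Data.Fin.Subset.Properties using (_∈?_; x∉p⇒x∈∁p; x∈∁p⇒x∉p; ∣∁p∣≡n∸∣p∣; ∣p∣≤n)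
open import Data.List using (List; []; _∷_; _∷ʳ_; allFin; cartesianProduct; filter; length; lookup; zip)
open import Data.List.Membership.Propositional using (_∈_; _∉_)
open import Data.List.Membership.Propositional.Properties using (∈-filter⁺; ∈-filter⁻; ∈-lookup; ∈-allFin; ∈-++⁻; ∈-cartesianProduct⁺)
open import Data.List.Relation.Unary.All as All using (All; []; _∷_)
open import Data.List.Relation.Unary.AllPairs as AllPairs using (AllPairs; []; _∷_)
open import Data.List.Relation.Unary.Any as Any using (Any; here; there)
open import Data.List.Relation.Unary.All.Properties using (¬Any⇒All¬)
open import Data.List.Relation.Unary.Any.Properties using (lookup-index)
open import Data.List.Relation.Unary.Unique.Propositional using (Unique)
open import Data.List.Relation.Unary.Unique.Propositional.Properties using (allFin⁺; cartesianProduct⁺; filter⁺; Unique[x∷xs]⇒x∉xs)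
open import Data.Nat using (ℕ; zero; suc; _+_; _*_; _/_; _≤_; z≤n; s≤s; s≤s⁻¹)
open import Data.Nat.Divisibility using (_∣_)
open import Data.Nat.DivMod using (m*[n/m]≡n)
open import Data.Nat.Properties using (+-identityʳ; *-cancelˡ-≡; m+[n∸m]≡n; ≤-antisym; ≤-trans; ≤-reflexive; 1+n≰n)
open import Data.Product using (Σ-syntax; ∃!; ∃-syntax; _×_; _,_; proj₁; proj₂; uncurry; swap)
open import Data.Product.Properties using (,-injective)
open import Data.Sum as Sum using (_⊎_; inj₁; inj₂)
open import Data.Vec as Vec using (here; there; []; _∷_)
open import Data.Vec.Properties using (lookup⇒[]=; []=⇒lookup; lookup∘tabulate)
open import Function using (mk⇔; _∘_; id; case_of_; Injective)
open import Relation.Binary using (tri<; tri≈; tri>)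
open import Relation.Binary.Construct.Closure.ReflexiveTransitive as Star using (Star; ε; _◅_; _◅◅_)
open import Relation.Binary.PropositionalEquality using (_≡_; _≢_; refl; sym; trans; cong; cong₂; subst; subst₂; module ≡-Reasoning)
open import Relation.Nullary using (¬_; Dec; yes; no; does; contradiction)
open import Relation.Nullary.Decidable using (dec-true; dec-false; does-⇔; _×-dec_)
open import Relation.Unary using (Decidable)
open import Defs

private
  variable
    A B : Set

-- Sums modulo two over lists, and parity.

xor-interchange : ∀ a b c d → (a xor b) xor (c xor d) ≡ (a xor c) xor (b xor d)
xor-interchange =
  interchange (CommutativeMonoid.commutativeSemigroup (CommutativeRing.+-commutativeMonoid xor-∧-commutativeRing))

xor≡false⇒≡ : ∀ a b → a xor b ≡ false → a ≡ b
xor≡false⇒≡ true  true  _ = refl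
xor≡false⇒≡ false false _ = refl

xor≡true⇒≡not : ∀ a b → a xor b ≡ true → a ≡ not b
xor≡true⇒≡not true  false _ = refl
xor≡true⇒≡not false true  _ = refl

⊕ : (A → Bool) → List A → Bool
⊕ f []       = false
⊕ f (x ∷ xs) = f x xor ⊕ f xs

⊕-cong : ∀ {f g : A → Bool} {xs} → All (λ x → f x ≡ g x) xs → ⊕ f xs ≡ ⊕ g xs
⊕-cong []           = refl
⊕-cong (fx≡gx ∷ eq) = cong₂ _xor_ fx≡gx (⊕-cong eq)

⊕-false : ∀ (xs : List A) → ⊕ (λ _ → false) xs ≡ false
⊕-false []       = refl
⊕-false (_ ∷ xs) = ⊕-false xs

⊕-xor : ∀ (f g : A → Bool) xs → ⊕ (λ x → f x xor g x) xs ≡ ⊕ f xs xor ⊕ g xs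
⊕-xor f g []       = refl
⊕-xor f g (x ∷ xs) = trans (cong ((f x xor g x) xor_) (⊕-xor f g xs))
                           (xor-interchange (f x) (g x) (⊕ f xs) (⊕ g xs))

⊕-swap : ∀ (f : A → B → Bool) xs ys →
         ⊕ (λ x → ⊕ (f x) ys) xs ≡ ⊕ (λ y → ⊕ (λ x → f x y) xs) ys
⊕-swap f []       ys = sym (⊕-false ys)
⊕-swap f (x ∷ xs) ys = trans (cong (⊕ (f x) ys xor_) (⊕-swap f xs ys))
                             (sym (⊕-xor (f x) (λ y → ⊕ (λ x → f x y) xs) ys))

module _ {P : A → Set} (P? : Decidable P) where

  ⊕-none : ∀ {xs} → All (¬_ ∘ P) xs → ⊕ (does ∘ P?) xs ≡ false
  ⊕-none {xs} none = trans (⊕-cong (All.map (dec-false (P? _)) none)) (⊕-false xs)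

  -- At most one entry satisfies `P`, so nothing cancels modulo two and parity detects existence.
  ⊕-indicator : ∀ {xs} → AllPairs (λ x y → ¬ (P x × P y)) xs →
                ⊕ (does ∘ P?) xs ≡ does (Any.any? P? xs)
  ⊕-indicator []              = refl
  ⊕-indicator {x ∷ xs} (exclusive ∷ rest) with P? x
  ... | yes px = cong not (⊕-none (All.map (λ ¬both py → ¬both (px , py)) exclusive))
  ... | no _   = ⊕-indicator rest

parity : ℕ → Bool
parity zero    = false
parity (suc m) = not (parity m)

parity≡false⇒¬Odd : ∀ m → parity m ≡ false → ¬ Odd m
parity≡false⇒¬Odd zero          _    ()
-- `suc (suc m) % 2` computes to `m % 2`, so only the parity hypothesis needs adjusting.
parity≡false⇒¬Odd (suc (suc m)) even = parity≡false⇒¬Odd m (trans (sym (not-involutive _)) even)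

¬Odd⇒parity≡false : ∀ m → ¬ Odd m → parity m ≡ false
¬Odd⇒parity≡false zero          _    = refl
¬Odd⇒parity≡false (suc zero)    ¬odd = contradiction refl ¬odd
¬Odd⇒parity≡false (suc (suc m)) ¬odd = trans (not-involutive _) (¬Odd⇒parity≡false m ¬odd)

parity-filter : ∀ {P : A → Set} (P? : Decidable P) xs →
                parity (length (filter P? xs)) ≡ ⊕ (does ∘ P?) xs
parity-filter P? []       = refl
parity-filter P? (x ∷ xs) with does (P? x)
... | true  = cong not (parity-filter P? xs)
... | false = parity-filter P? xs

-- Walks and cycles as lists of edges.

-- The walk starts at u, passes through vs and ends at w, so cycleEdges c is walkEdges base others base.
walkEdges : A → List A → A → List (A × A)
walkEdges u vs w = zip (u ∷ vs) (vs ∷ʳ w)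

-- Each inner vertex belongs to two consecutive edges, so its value cancels.
⊕-telescope : ∀ (f : A → Bool) u vs w →
              ⊕ (λ (a , b) → f a xor f b) (walkEdges u vs w) ≡ f u xor f w
⊕-telescope f u []       w = xor-identityʳ _
⊕-telescope f u (v ∷ vs) w = begin
  (f u xor f v) xor ⊕ _ (walkEdges v vs w)  ≡⟨ cong ((f u xor f v) xor_) (⊕-telescope f v vs w) ⟩
  (f u xor f v) xor (f v xor f w)           ≡⟨ xor-assoc (f u) (f v) _ ⟩
  f u xor (f v xor (f v xor f w))           ≡⟨ cong (f u xor_) (xor-assoc (f v) (f v) (f w)) ⟨
  f u xor ((f v xor f v) xor f w)           ≡⟨ cong (λ b → f u xor (b xor f w)) (xor-same (f v)) ⟩
  f u xor f w                               ∎
  where open ≡-Reasoning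

walkEdges-endpoints : ∀ (u : A) vs w →
                      All (λ (p , q) → p ∈ u ∷ vs × q ∈ vs ∷ʳ w) (walkEdges u vs w)
walkEdges-endpoints u []       w = (here refl , here refl) ∷ []
walkEdges-endpoints u (v ∷ vs) w =
  (here refl , here refl) ∷ All.map (λ (p∈ , q∈) → there p∈ , there q∈) (walkEdges-endpoints v vs w)

∈-∷ʳ⁻ : ∀ {x w : A} vs → x ∈ vs ∷ʳ w → x ∈ vs ⊎ x ≡ w
∈-∷ʳ⁻ vs x∈ with ∈-++⁻ vs x∈
... | inj₁ x∈vs       = inj₁ x∈vs
... | inj₂ (here x≡w) = inj₂ x≡w

module _ {n : ℕ} where

  _≭_ : Fin n × Fin n → Fin n × Fin n → Set
  e ≭ f = ¬ (e ≐ f)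

  ≐-refl : ∀ {e : Fin n × Fin n} → e ≐ e
  ≐-refl = inj₁ (refl , refl)

  ≐-flip : ∀ {u v : Fin n} → (u , v) ≐ (v , u)
  ≐-flip = inj₂ (refl , refl)

  ≐-sym : ∀ {e f : Fin n × Fin n} → e ≐ f → f ≐ e
  ≐-sym (inj₁ (refl , refl)) = ≐-refl
  ≐-sym (inj₂ (refl , refl)) = ≐-flip

  ≐-trans : ∀ {e f g : Fin n × Fin n} → e ≐ f → f ≐ g → e ≐ g
  ≐-trans (inj₁ (refl , refl)) f≐g                  = f≐g
  ≐-trans (inj₂ (refl , refl)) (inj₁ (refl , refl)) = ≐-flip
  ≐-trans (inj₂ (refl , refl)) (inj₂ (refl , refl)) = ≐-refl

  -- No later edge touches `u`: inner vertices are fresh and the end `w` is not on the list. The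
  -- first edge can therefore not recur in either direction.
  walkEdges-distinct : ∀ (u : Fin n) vs w → Unique (u ∷ vs) → w ∉ u ∷ vs →
                       AllPairs _≭_ (walkEdges u vs w)
  walkEdges-distinct u []       w _              _  = [] ∷ []
  walkEdges-distinct u (v ∷ vs) w (u∉ ∷ unique) w∉ =
    All.map head≭ (walkEdges-endpoints v vs w) ∷ walkEdges-distinct v vs w unique (w∉ ∘ there)
    where
    head≭ : ∀ {e} → proj₁ e ∈ v ∷ vs × proj₂ e ∈ vs ∷ʳ w → (u , v) ≭ e
    head≭ (p∈ , _) (inj₁ (refl , _)) = All.lookup u∉ p∈ refl
    head≭ (_ , q∈) (inj₂ (refl , _)) with ∈-∷ʳ⁻ vs q∈
    ... | inj₁ q∈vs = All.lookup u∉ (there q∈vs) refl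
    ... | inj₂ refl = w∉ (here refl)

  -- Without its first edge the closed walk is an open one from `v` to `b`, so only the edge from
  -- `b` to `v` has to be compared by hand. The length bound excludes the walk from `b` to `v` and
  -- back, which repeats its edge.
  closedWalkEdges-distinct : ∀ (b : Fin n) vs → 2 ≤ length vs → Unique (b ∷ vs) →
                             AllPairs _≭_ (walkEdges b vs b)
  closedWalkEdges-distinct b (v ∷ [])      (s≤s ()) _
  closedWalkEdges-distinct b (v ∷ v₁ ∷ vs) _ unique@(b∉ ∷ (v∉ ∷ _)) =
    (first≭second ∷ All.map first≭later (walkEdges-endpoints v₁ vs b))
    ∷ walkEdges-distinct v (v₁ ∷ vs) b (AllPairs.tail unique) (Unique[x∷xs]⇒x∉xs unique)
    where
    first≭second : (b , v) ≭ (v , v₁)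
    first≭second (inj₁ (b≡v , _))  = All.lookup b∉ (here refl) b≡v
    first≭second (inj₂ (b≡v₁ , _)) = All.lookup b∉ (there (here refl)) b≡v₁
    first≭later : ∀ {e} → proj₁ e ∈ v₁ ∷ vs × proj₂ e ∈ vs ∷ʳ b → (b , v) ≭ e
    first≭later (p∈ , _) (inj₁ (refl , _)) = All.lookup b∉ (there p∈) refl
    first≭later (p∈ , _) (inj₂ (_ , refl)) = All.lookup v∉ p∈ refl

-- Counting by injections.

lookup-injective : ∀ {xs : List A} → Unique xs → ∀ {i j} → lookup xs i ≡ lookup xs j → i ≡ j
lookup-injective {xs = _ ∷ _} (x∉ ∷ _) {zero}  {zero}  _  = refl
lookup-injective {xs = _ ∷ _} (x∉ ∷ _) {zero}  {suc j} eq = contradiction eq (All.lookup x∉ (∈-lookup j))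
lookup-injective {xs = _ ∷ _} (x∉ ∷ _) {suc i} {zero}  eq = contradiction (sym eq) (All.lookup x∉ (∈-lookup i))
lookup-injective {xs = _ ∷ _} (_ ∷ unique) {suc i} {suc j} eq = cong suc (lookup-injective unique eq)

-- Sending each position in `xs` to a position of the same element in `ys` is injective, since `xs`
-- has no repetitions.
Unique-⊆⇒length≤ : ∀ {xs ys : List A} → Unique xs → (∀ {x} → x ∈ xs → x ∈ ys) → length xs ≤ length ys
Unique-⊆⇒length≤ {xs = xs} {ys} unique xs⊆ys = injective⇒≤ {f = position} position-injective
  where
  position : Fin (length xs) → Fin (length ys)
  position i = Any.index (xs⊆ys (∈-lookup i))
  position-injective : Injective _≡_ _≡_ position
  position-injective {i} {j} eq = lookup-injective unique (begin
    lookup xs i             ≡⟨ lookup-index (xs⊆ys (∈-lookup i)) ⟩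
    lookup ys (position i)  ≡⟨ cong (lookup ys) eq ⟩
    lookup ys (position j)  ≡⟨ lookup-index (xs⊆ys (∈-lookup j)) ⟨
    lookup xs j             ∎)
    where open ≡-Reasoning

-- A missed value `j` could serve as the image of one extra point, giving an injection from
-- `Fin (suc n)` to `Fin n`.
injective⇒surjective : ∀ {m n} {f : Fin m → Fin n} → n ≡ m → Injective _≡_ _≡_ f →
                       ∀ j → ∃[ i ] f i ≡ j
injective⇒surjective {n} {f = f} refl f-injective j with any? (λ i → f i ≟ j)
... | yes hit  = hit
... | no  miss = contradiction (injective⇒≤ extension-injective) 1+n≰n
  where
  extension : Fin (suc n) → Fin n
  extension zero    = j
  extension (suc i) = f i
  extension-injective : Injective _≡_ _≡_ extension
  extension-injective {zero}  {zero}  _  = refl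
  extension-injective {zero}  {suc i} eq = contradiction (i , sym eq) miss
  extension-injective {suc i} {zero}  eq = contradiction (i , eq) miss
  extension-injective {suc i} {suc k} eq = cong suc (f-injective eq)

-- The increasing enumeration of `S`. It provides the index set for the paths of the converse.
element : ∀ {n} (S : Subset n) → Fin ∣ S ∣ → Fin n
element (true  ∷ S) zero    = zero
element (true  ∷ S) (suc i) = suc (element S i)
element (false ∷ S) i       = suc (element S i)

element-∈ : ∀ {n} (S : Subset n) i → element S i ∈ˢ S
element-∈ (true  ∷ S) zero    = here
element-∈ (true  ∷ S) (suc i) = there (element-∈ S i)
element-∈ (false ∷ S) i       = there (element-∈ S i)

element-injective : ∀ {n} (S : Subset n) → Injective _≡_ _≡_ (element S)
element-injective (true  ∷ S) {zero}  {zero}  _  = refl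
element-injective (true  ∷ S) {suc i} {suc j} eq = cong suc (element-injective S (suc-injective eq))
element-injective (false ∷ S) eq                 = element-injective S (suc-injective eq)

element-surjective : ∀ {n} (S : Subset n) {v} → v ∈ˢ S → ∃[ i ] element S i ≡ v
element-surjective (true  ∷ S) here       = zero , refl
element-surjective (true  ∷ S) (there v∈) = let i , eq = element-surjective S v∈ in suc i , cong suc eq
element-surjective (false ∷ S) (there v∈) = let i , eq = element-surjective S v∈ in i , cong suc eq

injection⇒∣∣≤ : ∀ {n} {S T : Subset n} (f : Fin n → Fin n) → Injective _≡_ _≡_ f →
                (∀ {v} → v ∈ˢ S → f v ∈ˢ T) → ∣ S ∣ ≤ ∣ T ∣
injection⇒∣∣≤ {S = S} {T} f f-injective f∈ = injective⇒≤ {f = index} index-injective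
  where
  located : ∀ i → ∃[ j ] element T j ≡ f (element S i)
  located i = element-surjective T (f∈ (element-∈ S i))
  index : Fin ∣ S ∣ → Fin ∣ T ∣
  index = proj₁ ∘ located
  index-injective : Injective _≡_ _≡_ index
  index-injective {i} {j} eq = element-injective S (f-injective
    (trans (sym (proj₂ (located i))) (trans (cong (element T) eq) (proj₂ (located j)))))

∣S∣+∣∁S∣≡n : ∀ {n} (S : Subset n) → ∣ S ∣ + ∣ ∁ S ∣ ≡ n
∣S∣+∣∁S∣≡n S = trans (cong (∣ S ∣ +_) (∣∁p∣≡n∸∣p∣ S)) (m+[n∸m]≡n (∣p∣≤n S))

m+m≡2*n⇒m≡n : ∀ {m n} → m + m ≡ 2 * n → m ≡ n
m+m≡2*n⇒m≡n {m} {n} eq = *-cancelˡ-≡ m n 2 (trans (cong (m +_) (+-identityʳ m)) eq)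

-- Bivariegations from a colouring and a matching.

-- Uniqueness of the differently coloured neighbour makes `partner` an involution. It exchanges the
-- two colour classes, so they have equal size, and each is half of the vertex set.
matching⇒bivariegated :
  ∀ (B : Graph) {n} (colour : Vertex B → Bool) (partner : Vertex B → Vertex B) → order B ≡ 2 * n →
  (∀ e → Graph.Adj B e (partner e)) →
  (∀ e → colour (partner e) ≡ not (colour e)) →
  (∀ e {f} → Graph.Adj B e f → colour f ≢ colour e → partner e ≡ f) →
  Bivariegated B
matching⇒bivariegated B {n} colour partner order≡2n adj-partner colour-partner partner-unique =
  n , order≡2n , S , ∣S∣≡n , trans (sym ∣S∣≡∣∁S∣) ∣S∣≡n , matched , matched′
  where
  open Graph B using (Adj; adj-sym)
  S : Subset (order B)
  S = Vec.tabulate colour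
  ∈S⁺ : ∀ {v} → colour v ≡ true → v ∈ˢ S
  ∈S⁺ {v} eq = lookup⇒[]= v S (trans (lookup∘tabulate colour v) eq)
  ∈S⁻ : ∀ {v} → v ∈ˢ S → colour v ≡ true
  ∈S⁻ {v} v∈ = trans (sym (lookup∘tabulate colour v)) ([]=⇒lookup v∈)
  ∈∁S⁺ : ∀ {v} → colour v ≡ false → v ∈ˢ ∁ S
  ∈∁S⁺ eq = x∉p⇒x∈∁p λ v∈ → case trans (sym eq) (∈S⁻ v∈) of λ ()
  ∈∁S⁻ : ∀ {v} → v ∈ˢ ∁ S → colour v ≡ false
  ∈∁S⁻ v∈ = ¬-not λ eq → x∈∁p⇒x∉p v∈ (∈S⁺ eq)
  involutive : ∀ e → partner (partner e) ≡ e
  involutive e = partner-unique (partner e) (adj-sym (adj-partner e))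
    λ eq → not-¬ refl (trans eq (colour-partner e))
  partner-injective : Injective _≡_ _≡_ partner
  partner-injective {e} {f} eq = trans (sym (involutive e)) (trans (cong partner eq) (involutive f))
  ∣S∣≡∣∁S∣ : ∣ S ∣ ≡ ∣ ∁ S ∣
  ∣S∣≡∣∁S∣ = ≤-antisym
    (injection⇒∣∣≤ partner partner-injective λ v∈ → ∈∁S⁺ (trans (colour-partner _) (cong not (∈S⁻ v∈))))
    (injection⇒∣∣≤ partner partner-injective λ v∈ → ∈S⁺ (trans (colour-partner _) (cong not (∈∁S⁻ v∈))))
  ∣S∣≡n : ∣ S ∣ ≡ n
  ∣S∣≡n = m+m≡2*n⇒m≡n (trans (cong (∣ S ∣ +_) ∣S∣≡∣∁S∣) (trans (∣S∣+∣∁S∣≡n S) order≡2n))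
  matched : ∀ v → v ∈ˢ S → ∃! _≡_ (λ w → w ∈ˢ ∁ S × Adj v w)
  matched v v∈ = partner v , (∈∁S⁺ (trans (colour-partner v) (cong not (∈S⁻ v∈))) , adj-partner v) ,
    λ (w∈ , vw) → partner-unique v vw λ eq → case trans (sym (∈∁S⁻ w∈)) (trans eq (∈S⁻ v∈)) of λ ()
  matched′ : ∀ v → v ∈ˢ ∁ S → ∃! _≡_ (λ w → w ∈ˢ S × Adj v w)
  matched′ v v∈ = partner v , (∈S⁺ (trans (colour-partner v) (cong not (∈∁S⁻ v∈))) , adj-partner v) ,
    λ (w∈ , vw) → partner-unique v vw λ eq → case trans (sym (∈S⁻ w∈)) (trans eq (∈∁S⁻ v∈)) of λ ()

-- Simple paths extracted from walks.

-- The end `w` comes first in `distinct` because that is the list required of a `Cycle` based at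
-- `w`, once an edge from `w` to `u` closes the path.
record SimplePath {n} (R : Fin n → Fin n → Set) (u w : Fin n) : Set where
  constructor simplePath
  field
    interior : List (Fin n)
    distinct : Unique (w ∷ u ∷ interior)
    steps    : All (uncurry R) (walkEdges u interior w)

module _ {n} {R : Fin n → Fin n → Set} where

  -- The part of the path before `u` is cut off.
  startingAt : ∀ {u v w} vs → Unique (w ∷ v ∷ vs) → All (uncurry R) (walkEdges v vs w) →
               u ∈ v ∷ vs → SimplePath R u w
  startingAt vs       distinct steps (here refl) = simplePath vs distinct steps
  startingAt (_ ∷ vs) ((_ ∷ w∉) ∷ (_ ∷ distinct)) (_ ∷ steps) (there u∈) =
    startingAt vs (w∉ ∷ distinct) steps u∈

  -- Loop erasure: the rest of the walk is made simple first. If `u` already lies on the result, the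
  -- path starts there; otherwise the step from `u` is put in front.
  walk⇒simplePath : ∀ {u w} → Star R u w → u ≡ w ⊎ SimplePath R u w
  walk⇒simplePath ε = inj₁ refl
  walk⇒simplePath {u} {w} (_◅_ {j = v} step walk) with u ≟ w | walk⇒simplePath walk
  ... | yes u≡w | _         = inj₁ u≡w
  ... | no  u≢w | inj₁ refl = inj₂ (simplePath [] (((u≢w ∘ sym) ∷ []) ∷ [] ∷ []) (step ∷ []))
  ... | no  u≢w | inj₂ (simplePath vs distinct@(w∉ ∷ distinct′) steps) with Any.any? (u ≟_) (v ∷ vs)
  ...   | yes u∈ = inj₂ (startingAt vs distinct steps u∈)
  ...   | no  u∉ = inj₂ (simplePath (v ∷ vs)
                     (((u≢w ∘ sym) ∷ w∉) ∷ ¬Any⇒All¬ _ u∉ ∷ distinct′) (step ∷ steps))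

-- The edge list, degree two, and potentials of balanced signings.

module _ (G : Graph) where

  open Graph G using (Adj; adj?; adj-sym; adj-irrefl; degree; edges)

  IsPotential : (Vertex G × Vertex G → Bool) → (Vertex G → Bool) → Set
  IsPotential σ pot = ∀ {u v} → Adj u v → pot u xor pot v ≡ σ (u , v)

  Balanced : (Vertex G × Vertex G → Bool) → Set
  Balanced σ = ∀ (c : Cycle G) → ⊕ σ (cycleEdges c) ≡ false

  potential⇒balanced : ∀ {σ pot} → IsPotential σ pot → Balanced σ
  potential⇒balanced {σ} {pot} isPotential c = begin
    ⊕ σ (cycleEdges c)                                  ≡⟨ ⊕-cong (All.map isPotential adjacent) ⟨
    ⊕ (λ (a , b) → pot a xor pot b) (cycleEdges c)      ≡⟨ ⊕-telescope pot base others base ⟩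
    pot base xor pot base                               ≡⟨ xor-same (pot base) ⟩
    false                                               ∎
    where
    open ≡-Reasoning
    open Cycle c using (base; others; adjacent)

  edge-position : ∀ {u v} → u <ᶠ v → Adj u v → ∃[ k ] (u , v) ≡ lookup edges k
  edge-position u<v uv = _ , lookup-index (∈-filter⁺ _ (∈-cartesianProduct⁺ (∈-allFin _) (∈-allFin _)) (u<v , uv))

  adj⇒position : ∀ {u v} → Adj u v → ∃[ k ] (u , v) ≐ lookup edges k
  adj⇒position {u} {v} uv with <-cmp u v
  ... | tri< u<v _ _ = let k , eq = edge-position u<v uv in k , inj₁ (,-injective eq)
  ... | tri≈ _ u≡v _ = contradiction uv (adj-irrefl u≡v)
  ... | tri> _ _ v<u = let k , eq = edge-position v<u (adj-sym uv) in k , inj₂ (swap (,-injective eq))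

  ∈-edges⁻ : ∀ {u v} → (u , v) ∈ edges → u <ᶠ v × Adj u v
  ∈-edges⁻ uv∈ = proj₂ (∈-filter⁻ _ {xs = cartesianProduct (allFin _) (allFin _)} uv∈)

  edges-unique : Unique edges
  edges-unique = filter⁺ _ (cartesianProduct⁺ (allFin⁺ _) (allFin⁺ _))

  -- The list has no repetitions, and it stores the smaller endpoint first, so an entry cannot be
  -- the reversal of another or of itself.
  position-unique : ∀ {k l} → lookup edges k ≐ lookup edges l → k ≡ l
  position-unique (inj₁ (p , q)) = lookup-injective edges-unique (cong₂ _,_ p q)
  position-unique {k} {l} (inj₂ (p , q)) =
    contradiction (proj₁ (∈-edges⁻ (∈-lookup l)))
      (<-asym (subst₂ _<ᶠ_ p q (proj₁ (∈-edges⁻ (∈-lookup k)))))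

  -- A third neighbour would put three distinct entries into a neighbour list of length two.
  neighbours-≡2 : ∀ {x y z v} → degree y ≡ 2 → Adj y x → Adj y z → x ≢ z → Adj y v → v ≡ x ⊎ v ≡ z
  neighbours-≡2 {x} {y} {z} {v} deg yx yz x≢z yv with v ≟ x | v ≟ z
  ... | yes v≡x | _       = inj₁ v≡x
  ... | no _    | yes v≡z = inj₂ v≡z
  ... | no v≢x  | no v≢z  = contradiction
    (≤-trans (Unique-⊆⇒length≤ distinct neighbours) (≤-reflexive deg)) 1+n≰n
    where
    distinct : Unique (v ∷ x ∷ z ∷ [])
    distinct = (v≢x ∷ v≢z ∷ []) ∷ (x≢z ∷ []) ∷ [] ∷ []
    neighbours : ∀ {w} → w ∈ v ∷ x ∷ z ∷ [] → w ∈ filter (adj? y) (allFin _)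
    neighbours (here refl)                 = ∈-filter⁺ (adj? y) (∈-allFin _) yv
    neighbours (there (here refl))         = ∈-filter⁺ (adj? y) (∈-allFin _) yx
    neighbours (there (there (here refl))) = ∈-filter⁺ (adj? y) (∈-allFin _) yz

  degree-≡2 : ∀ {x y z} → Adj y x → Adj y z → x ≢ z → (∀ {v} → Adj y v → v ≡ x ⊎ v ≡ z) → degree y ≡ 2
  degree-≡2 {x} {y} {z} yx yz x≢z only = ≤-antisym
    (Unique-⊆⇒length≤ (filter⁺ (adj? y) (allFin⁺ _)) ⊆pair)
    (Unique-⊆⇒length≤ ((x≢z ∷ []) ∷ [] ∷ []) pair⊆)
    where
    ⊆pair : ∀ {w} → w ∈ filter (adj? y) (allFin _) → w ∈ x ∷ z ∷ []
    ⊆pair w∈ with only (proj₂ (∈-filter⁻ (adj? y) {xs = allFin _} w∈))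
    ... | inj₁ w≡x = here w≡x
    ... | inj₂ w≡z = there (here w≡z)
    pair⊆ : ∀ {w} → w ∈ x ∷ z ∷ [] → w ∈ filter (adj? y) (allFin _)
    pair⊆ (here refl)         = ∈-filter⁺ (adj? y) (∈-allFin _) yx
    pair⊆ (there (here refl)) = ∈-filter⁺ (adj? y) (∈-allFin _) yz

  -- Harary's theorem on balanced signed graphs: edges are added one at a time, together with a labelling of
  -- the components formed so far; a new edge either closes a cycle or allows one component to be flipped.
  module _ {σ : Vertex G × Vertex G → Bool} (σ-resp : ∀ {e f} → e ≐ f → σ e ≡ σ f)
           (balanced : Balanced σ) where

    -- `consistent` makes labels constant along edges; `connected` is the reverse direction, kept as
    -- an actual walk because a cycle has to be built from it when an edge is added inside a
    -- component.
    record PartialPotential (es : List (Vertex G × Vertex G)) : Set where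
      field
        pot        : Vertex G → Bool
        component  : Vertex G → Vertex G
        consistent : ∀ {u v} → (u , v) ∈ᵉ es → component u ≡ component v × pot u xor pot v ≡ σ (u , v)
        connected  : ∀ {u v} → component u ≡ component v → Star (λ a b → (a , b) ∈ᵉ es) u v

    ∈ᵉ⇒adj : ∀ {es} → All (uncurry Adj) es → ∀ {u v} → (u , v) ∈ᵉ es → Adj u v
    ∈ᵉ⇒adj (ab ∷ _)  (here (inj₁ (refl , refl))) = ab
    ∈ᵉ⇒adj (ab ∷ _)  (here (inj₂ (refl , refl))) = adj-sym ab
    ∈ᵉ⇒adj (_ ∷ abs) (there uv∈)                 = ∈ᵉ⇒adj abs uv∈

    module _ {a b es} (ab : Adj a b) (abs : All (uncurry Adj) es) (partial : PartialPotential es) where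

      open PartialPotential partial

      -- A simple path of old edges from `a` to `b` closes up with the new edge. Balance equates the
      -- sign of that edge with the sum along the path, which telescopes to the difference of
      -- potentials.
      new-consistent : component a ≡ component b → pot a xor pot b ≡ σ (a , b)
      new-consistent same with walk⇒simplePath (connected same)
      ... | inj₁ a≡b = contradiction ab (adj-irrefl a≡b)
      -- A path with one edge is the new edge itself, already present in `es`; no cycle arises and
      -- the old potential is right.
      ... | inj₂ (simplePath [] _ (ab∈ ∷ [])) = proj₂ (consistent ab∈)
      ... | inj₂ (simplePath (v ∷ vs) distinct steps) = begin
        pot a xor pot b                                                ≡⟨ ⊕-telescope pot a (v ∷ vs) b ⟨
        ⊕ (λ (p , q) → pot p xor pot q) (walkEdges a (v ∷ vs) b)       ≡⟨ ⊕-cong (All.map (proj₂ ∘ consistent) steps) ⟩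
        -- The edges of `closed` are `(b , a)` followed by those of the walk.
        ⊕ σ (walkEdges a (v ∷ vs) b)                                   ≡⟨ xor≡false⇒≡ (σ (b , a)) _ (balanced closed) ⟨
        σ (b , a)                                                      ≡⟨ σ-resp ≐-flip ⟩
        σ (a , b)                                                      ∎
        where
        open ≡-Reasoning
        closed : Cycle G
        closed = record
          { base     = b
          ; others   = a ∷ v ∷ vs
          ; length≥3 = s≤s (s≤s (s≤s z≤n))
          ; distinct = distinct
          ; adjacent = adj-sym ab ∷ All.map (∈ᵉ⇒adj abs) steps
          }

      weaken : ∀ {u v} → Star (λ p q → (p , q) ∈ᵉ es) u v → Star (λ p q → (p , q) ∈ᵉ ((a , b) ∷ es)) u v
      weaken = Star.map there

      sameComponent : component a ≡ component b → PartialPotential ((a , b) ∷ es)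
      sameComponent same = record
        { pot        = pot
        ; component  = component
        ; consistent = λ where
            (here (inj₁ (refl , refl))) → same , new-consistent same
            (here (inj₂ (refl , refl))) →
              sym same , trans (xor-comm (pot b) (pot a)) (trans (new-consistent same) (σ-resp ≐-flip))
            (there uv∈)                 → consistent uv∈
        ; connected  = weaken ∘ connected
        }

      module _ (different : component a ≢ component b) where

        -- The error of `pot` at the new edge, applied to the whole component of `a`. Being constant
        -- on old components it leaves old edges alone, and as `b` lies elsewhere it repairs the new
        -- one.
        correction : Vertex G → Bool
        correction w = if does (component w ≟ component a) then (pot a xor pot b) xor σ (a , b) else false

        flipped : Vertex G → Bool
        flipped w = pot w xor correction w

        merged : Vertex G → Vertex G
        merged w = if does (component w ≟ component a) then component b else component w

        flipped-old : ∀ {u v} → component u ≡ component v → flipped u xor flipped v ≡ pot u xor pot v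
        flipped-old {u} {v} same = begin
          flipped u xor flipped v
            ≡⟨ xor-interchange (pot u) _ (pot v) _ ⟩
          (pot u xor pot v) xor (correction u xor correction v)
            -- `correction u` depends on `u` only through `component u`.
            ≡⟨ cong (λ c → (pot u xor pot v) xor ((if does (c ≟ component a) then _ else false) xor correction v)) same ⟩
          (pot u xor pot v) xor (correction v xor correction v)
            ≡⟨ cong ((pot u xor pot v) xor_) (xor-same (correction v)) ⟩
          (pot u xor pot v) xor false
            ≡⟨ xor-identityʳ _ ⟩
          pot u xor pot v
            ∎
          where open ≡-Reasoning

        flipped-new : flipped a xor flipped b ≡ σ (a , b)
        flipped-new
          rewrite dec-true (component a ≟ component a) refl
                | dec-false (component b ≟ component a) (different ∘ sym) = begin
          (pot a xor (δ xor σ (a , b))) xor (pot b xor false)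
            ≡⟨ xor-interchange (pot a) _ (pot b) false ⟩
          δ xor ((δ xor σ (a , b)) xor false)
            ≡⟨ cong (δ xor_) (xor-identityʳ _) ⟩
          δ xor (δ xor σ (a , b))
            ≡⟨ xor-assoc δ δ _ ⟨
          (δ xor δ) xor σ (a , b)
            ≡⟨ cong (_xor σ (a , b)) (xor-same δ) ⟩
          σ (a , b)
            ∎
          where
          open ≡-Reasoning
          δ = pot a xor pot b

        merged-old : ∀ {u v} → component u ≡ component v → merged u ≡ merged v
        merged-old = cong (λ c → if does (c ≟ component a) then component b else c)

        merged-new : merged a ≡ merged b
        merged-new
          rewrite dec-true (component a ≟ component a) refl
                | dec-false (component b ≟ component a) (different ∘ sym) = refl

        merged-connected : ∀ {u v} → merged u ≡ merged v → Star (λ p q → (p , q) ∈ᵉ ((a , b) ∷ es)) u v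
        merged-connected {u} {v} eq with component u ≟ component a | component v ≟ component a
        ... | yes u~a | yes v~a = weaken (connected (trans u~a (sym v~a)))
        -- Here `eq` says that `v` is in the old component of `b`: the walk runs from `u` to `a`,
        -- over the new edge, and from `b` to `v`. The next case is its mirror image.
        ... | yes u~a | no  _   = weaken (connected u~a) ◅◅ here ≐-refl ◅ weaken (connected eq)
        ... | no  _   | yes v~a = weaken (connected eq) ◅◅ here ≐-flip ◅ weaken (connected (sym v~a))
        ... | no  _   | no  _   = weaken (connected eq)

        differentComponents : PartialPotential ((a , b) ∷ es)
        differentComponents = record
          { pot        = flipped
          ; component  = merged
          ; consistent = λ where
              (here (inj₁ (refl , refl))) → merged-new , flipped-new
              (here (inj₂ (refl , refl))) →
                sym merged-new , trans (xor-comm (flipped b) (flipped a)) (trans flipped-new (σ-resp ≐-flip))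
              (there uv∈) → let same , value = consistent uv∈ in
                merged-old same , trans (flipped-old same) value
          ; connected  = merged-connected
          }

    partialPotential : ∀ es → All (uncurry Adj) es → PartialPotential es
    partialPotential [] [] = record
      { pot        = λ _ → false
      -- Without edges every vertex is a component of its own.
      ; component  = id
      ; consistent = λ ()
      ; connected  = λ { refl → ε }
      }
    partialPotential ((a , b) ∷ es) (ab ∷ abs) with partialPotential es abs
    ... | partial with PartialPotential.component partial a ≟ PartialPotential.component partial b
    ...   | yes same      = sameComponent ab abs partial same
    ...   | no  different = differentComponents ab abs partial different

    balanced⇒potential : ∃[ pot ] IsPotential σ pot
    balanced⇒potential = pot , λ uv → proj₂ (consistent (edge∈ uv))
      where
      open PartialPotential
        (partialPotential edges (All.tabulate (proj₂ ∘ ∈-edges⁻)))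
      edge∈ : ∀ {u v} → Adj u v → (u , v) ∈ᵉ edges
      edge∈ uv = let k , uv≐ = adj⇒position uv in Any.map (λ { refl → uv≐ }) (∈-lookup {xs = edges} k)

-- Cycles through a vertex of degree two.

-- A cycle has at least three vertices and so never uses an edge twice; hence `e` is counted at most
-- once.
cycleEdges-indicator : ∀ {G} (c : Cycle G) e →
                       ⊕ (does ∘ (e ≐?_)) (cycleEdges c) ≡ does (e ∈ᵉ? cycleEdges c)
cycleEdges-indicator c e = ⊕-indicator (e ≐?_)
  (AllPairs.map (λ f≭g (e≐f , e≐g) → f≭g (≐-trans (≐-sym e≐f) e≐g))
    (closedWalkEdges-distinct base others (s≤s⁻¹ length≥3) distinct))
  where open Cycle c

-- At the degree-two vertex y the indicator of y telescopes to zero around c, so the two edges at y lie on c together.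
firstEdge∈⇒secondEdge∈ : ∀ {G} (p : XYZPath G) (c : Cycle G) → let open XYZPath p in
                         (x , y) ∈ᵉ cycleEdges c → (y , z) ∈ᵉ cycleEdges c
firstEdge∈⇒secondEdge∈ {G} p c xy∈ with (XYZPath.y p , XYZPath.z p) ∈ᵉ? cycleEdges c
... | yes yz∈ = yz∈
... | no  yz∉ = case trans (sym contradictory) vanishing of λ ()
  where
  open XYZPath p
  open Graph G using (Adj; adj-sym; adj-irrefl)
  open Cycle c using (base; others; adjacent)
  open ≡-Reasoning

  -- Both sides indicate whether the edge is incident with `y`: by the degree condition the edges at
  -- `y` are exactly `xy` and `yz`, and an edge of `G` has `y` as at most one end.
  at-y : ∀ {a b} → Adj a b → does (a ≟ y) xor does (b ≟ y) ≡
                              does ((x , y) ≐? (a , b)) xor does ((y , z) ≐? (a , b))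
  at-y {a} {b} ab with a ≟ y | b ≟ y
  ... | yes refl | yes refl = contradiction ab (adj-irrefl refl)
  ... | yes refl | no  _ with neighbours-≡2 G degree-y (adj-sym adj-xy) adj-yz x≢z ab
  ...   | inj₁ refl = sym (cong₂ _xor_
            (dec-true ((x , y) ≐? (y , x)) ≐-flip)
            (dec-false ((y , z) ≐? (y , x)) λ { (inj₁ (_ , z≡x)) → x≢z (sym z≡x) ; (inj₂ (y≡x , _)) → x≢y (sym y≡x) }))
  ...   | inj₂ refl = sym (cong₂ _xor_
            (dec-false ((x , y) ≐? (y , z)) λ { (inj₁ (x≡y , _)) → x≢y x≡y ; (inj₂ (x≡z , _)) → x≢z x≡z })
            (dec-true ((y , z) ≐? (y , z)) ≐-refl))
  at-y {a} {b} ab | no _ | yes refl with neighbours-≡2 G degree-y (adj-sym adj-xy) adj-yz x≢z (adj-sym ab)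
  ...   | inj₁ refl = sym (cong₂ _xor_
            (dec-true ((x , y) ≐? (x , y)) ≐-refl)
            (dec-false ((y , z) ≐? (x , y)) λ { (inj₁ (y≡x , _)) → x≢y (sym y≡x) ; (inj₂ (_ , z≡x)) → x≢z (sym z≡x) }))
  ...   | inj₂ refl = sym (cong₂ _xor_
            (dec-false ((x , y) ≐? (z , y)) λ { (inj₁ (x≡z , _)) → x≢z x≡z ; (inj₂ (x≡y , _)) → x≢y x≡y })
            (dec-true ((y , z) ≐? (z , y)) ≐-flip))
  at-y {a} {b} ab | no a≢y | no b≢y = sym (cong₂ _xor_
    (dec-false ((x , y) ≐? (a , b)) λ { (inj₁ (_ , refl)) → b≢y refl ; (inj₂ (_ , refl)) → a≢y refl })
    (dec-false ((y , z) ≐? (a , b)) λ { (inj₁ (refl , _)) → a≢y refl ; (inj₂ (refl , _)) → b≢y refl }))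

  vanishing : ⊕ (λ e → does ((x , y) ≐? e) xor does ((y , z) ≐? e)) (cycleEdges c) ≡ false
  vanishing = begin
    ⊕ (λ e → does ((x , y) ≐? e) xor does ((y , z) ≐? e)) (cycleEdges c)  ≡⟨ ⊕-cong (All.map at-y adjacent) ⟨
    ⊕ (λ (a , b) → does (a ≟ y) xor does (b ≟ y)) (cycleEdges c)          ≡⟨ ⊕-telescope (λ v → does (v ≟ y)) base others base ⟩
    does (base ≟ y) xor does (base ≟ y)                                   ≡⟨ xor-same (does (base ≟ y)) ⟩
    false                                                                 ∎

  contradictory : ⊕ (λ e → does ((x , y) ≐? e) xor does ((y , z) ≐? e)) (cycleEdges c) ≡ true
  contradictory = begin
    ⊕ (λ e → does ((x , y) ≐? e) xor does ((y , z) ≐? e)) (cycleEdges c)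
      ≡⟨ ⊕-xor _ _ (cycleEdges c) ⟩
    ⊕ (does ∘ ((x , y) ≐?_)) (cycleEdges c) xor ⊕ (does ∘ ((y , z) ≐?_)) (cycleEdges c)
      ≡⟨ cong₂ _xor_ (cycleEdges-indicator c (x , y)) (cycleEdges-indicator c (y , z)) ⟩
    does ((x , y) ∈ᵉ? cycleEdges c) xor does ((y , z) ∈ᵉ? cycleEdges c)
      ≡⟨ cong₂ _xor_ (dec-true (_ ∈ᵉ? cycleEdges c) xy∈) (dec-false (_ ∈ᵉ? cycleEdges c) yz∉) ⟩
    true
      ∎

-- The signing given by a path system.

module PathSystem {G : Graph} {k} (P : Fin k → XYZPath G) (disjoint : ∀ i j → i ≢ j → Disjoint (P i) (P j)) where

  firstEdge : Fin k → Vertex G × Vertex G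
  firstEdge i = let open XYZPath (P i) in x , y

  -- A sum over the paths rather than a membership test, so that it can be exchanged with the sum
  -- over the edges of a cycle.
  sign : Vertex G × Vertex G → Bool
  sign e = ⊕ (λ i → does (firstEdge i ≐? e)) (allFin k)

  -- By disjointness an edge is the first edge of at most one path.
  sign≡any : ∀ e → sign e ≡ does (Any.any? (λ i → firstEdge i ≐? e) (allFin k))
  sign≡any e = ⊕-indicator (λ i → firstEdge i ≐? e) (AllPairs.map exclusive (allFin⁺ k))
    where
    exclusive : ∀ {i j} → i ≢ j → ¬ (firstEdge i ≐ e × firstEdge j ≐ e)
    exclusive i≢j (i≐e , j≐e) =
      disjoint _ _ i≢j (firstEdge _ , here ≐-refl , here (≐-trans i≐e (≐-sym j≐e)))

  sign-true : ∀ {i e} → firstEdge i ≐ e → sign e ≡ true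
  sign-true {i} {e} i≐e = trans (sign≡any e)
    (dec-true (Any.any? _ (allFin k)) (Any.map (λ { refl → i≐e }) (∈-allFin i)))

  sign-false : ∀ {e} → (∀ i → ¬ (firstEdge i ≐ e)) → sign e ≡ false
  sign-false none = ⊕-none (λ i → firstEdge i ≐? _) {xs = allFin k} (All.tabulate (λ {i} _ → none i))

  sign-resp : ∀ {e f} → e ≐ f → sign e ≡ sign f
  sign-resp {e} {f} e≐f = ⊕-cong {xs = allFin k} (All.tabulate λ {i} _ →
    does-⇔ (mk⇔ (λ i≐e → ≐-trans i≐e e≐f) (λ i≐f → ≐-trans i≐f (≐-sym e≐f)))
           (firstEdge i ≐? e) (firstEdge i ≐? f))

  -- Double counting of pairs of a path and an equal edge of `c`: a path lies on `c` as soon as its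
  -- first edge does, and that edge occurs once.
  numContained-parity : ∀ c → parity (numContained c P) ≡ ⊕ sign (cycleEdges c)
  numContained-parity c = begin
    parity (numContained c P)                                            ≡⟨ parity-filter (λ i → contains? c (P i)) (allFin k) ⟩
    ⊕ (λ i → does (contains? c (P i))) (allFin k)                        ≡⟨ ⊕-cong (All.tabulate {xs = allFin k} λ {i} _ → contains≡ i) ⟩
    ⊕ (λ i → ⊕ (λ e → does (firstEdge i ≐? e)) (cycleEdges c)) (allFin k) ≡⟨ ⊕-swap _ (allFin k) (cycleEdges c) ⟩
    ⊕ sign (cycleEdges c)                                                ∎
    where
    open ≡-Reasoning
    contains≡ : ∀ i → does (contains? c (P i)) ≡ ⊕ (λ e → does (firstEdge i ≐? e)) (cycleEdges c)
    contains≡ i = trans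
      (does-⇔ (mk⇔ All.head (λ xy∈ → xy∈ ∷ firstEdge∈⇒secondEdge∈ (P i) c xy∈ ∷ []))
              (contains? c (P i)) (firstEdge i ∈ᵉ? cycleEdges c))
      (sym (cycleEdges-indicator c (firstEdge i)))

  noOddCycle⇒balanced : ¬ (∃[ c ] Odd (numContained c P)) → Balanced G sign
  noOddCycle⇒balanced ¬odd c =
    trans (sym (numContained-parity c)) (¬Odd⇒parity≡false (numContained c P) λ odd → ¬odd (c , odd))

  balanced⇒noOddCycle : Balanced G sign → ¬ (∃[ c ] Odd (numContained c P))
  balanced⇒noOddCycle balanced (c , odd) =
    parity≡false⇒¬Odd (numContained c P) (trans (numContained-parity c) (balanced c)) odd

-- Endpoints of unordered edges.

endpoint-resp : ∀ {n} {w : Fin n} {e f} → e ≐ f → IsEndpoint w e → IsEndpoint w f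
endpoint-resp (inj₁ (refl , refl)) w∈ = w∈
endpoint-resp (inj₂ (refl , refl)) w∈ = Sum.swap w∈

otherEndpoint : ∀ {n} {w : Fin n} e → IsEndpoint w e → ∃[ v ] (v , w) ≐ e
otherEndpoint (u , v) (inj₁ refl) = v , ≐-flip
otherEndpoint (u , v) (inj₂ refl) = u , ≐-refl

-- From a path system to a bivariegation.

module Sufficiency (G : Graph) {k} (size≡2k : size G ≡ 2 * k) (P : Fin k → XYZPath G)
                   (disjoint : ∀ i j → i ≢ j → Disjoint (P i) (P j)) (¬odd : ¬ (∃[ c ] Odd (numContained c P))) where

  open Graph G using (Adj; adj-sym; adj-irrefl; edges)
  open PathSystem P disjoint

  -- Naming the two ends of a path by a Boolean lets `not` pass from one edge of the path to the
  -- other.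
  outer : Fin k → Bool → Vertex G
  outer i true  = XYZPath.x (P i)
  outer i false = XYZPath.z (P i)

  middle : Fin k → Vertex G
  middle i = XYZPath.y (P i)

  arm : Fin k → Bool → Vertex G × Vertex G
  arm i b = outer i b , middle i

  arm-adj : ∀ i b → Adj (outer i b) (middle i)
  arm-adj i true  = XYZPath.adj-xy (P i)
  arm-adj i false = adj-sym (XYZPath.adj-yz (P i))

  arm∈ : ∀ i b → arm i b ∈ᵉ pathEdges (P i)
  arm∈ i true  = here ≐-refl
  arm∈ i false = there (here ≐-flip)

  arm-injectiveˡ : ∀ {i j b d} → arm i b ≐ arm j d → i ≡ j
  arm-injectiveˡ {i} {j} {b} {d} eq with i ≟ j
  ... | yes i≡j = i≡j
  ... | no  i≢j = contradiction (arm i b , arm∈ i b , Any.map (≐-trans eq) (arm∈ j d)) (disjoint i j i≢j)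

  outer-injective : ∀ {i b d} → outer i b ≡ outer i d → b ≡ d
  outer-injective {i} {true}  {true}  _  = refl
  outer-injective {i} {true}  {false} eq = contradiction eq (XYZPath.x≢z (P i))
  outer-injective {i} {false} {true}  eq = contradiction (sym eq) (XYZPath.x≢z (P i))
  outer-injective {i} {false} {false} _  = refl

  arm-injective : ∀ {i b j d} → arm i b ≐ arm j d → i ≡ j × b ≡ d
  arm-injective {i} {b} {j} {d} eq with refl ← arm-injectiveˡ {i} {j} {b} {d} eq | eq
  ... | inj₁ (outer≡outer , _)  = refl , outer-injective {i} outer≡outer
  ... | inj₂ (outer≡middle , _) = contradiction (arm-adj i b) (adj-irrefl outer≡middle)

  position : Fin k → Bool → Fin (size G)
  position i b = proj₁ (adj⇒position G (arm-adj i b))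

  position-≐ : ∀ i b → arm i b ≐ lookup edges (position i b)
  position-≐ i b = proj₂ (adj⇒position G (arm-adj i b))

  position-injective : ∀ {i b j d} → position i b ≡ position j d → i ≡ j × b ≡ d
  position-injective {i} {b} {j} {d} eq = arm-injective (≐-trans (position-≐ i b)
    (subst (λ e → lookup edges e ≐ arm j d) (sym eq) (≐-sym (position-≐ j d))))

  -- The `2 * k` arms are distinct edges and `G` has only `2 * k` edges, so the paths use all of
  -- them. `remQuot` splits an index into a side and a path.
  covered : ∀ e → ∃[ i ] ∃[ b ] position i b ≡ e
  covered e = let r , eq = injective⇒surjective size≡2k enumerate-injective e
                  s , i = remQuot {2} k r
              in i , side s , eq
    where
    side : Fin 2 → Bool
    side zero       = true
    side (suc zero) = false
    side-injective : ∀ {s t} → side s ≡ side t → s ≡ t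
    side-injective {zero}     {zero}     _ = refl
    side-injective {suc zero} {suc zero} _ = refl
    side-injective {zero}     {suc zero} ()
    side-injective {suc zero} {zero}     ()
    enumerate : Fin (2 * k) → Fin (size G)
    enumerate r = let s , i = remQuot {2} k r in position i (side s)
    enumerate-injective : Injective _≡_ _≡_ enumerate
    enumerate-injective {r} {r′} eq =
      let i≡j , s≡t = position-injective {b = side (proj₁ (remQuot {2} k r))}
                                         {d = side (proj₁ (remQuot {2} k r′))} eq in
      trans (sym (combine-remQuot {2} k r))
        (trans (cong₂ combine (side-injective s≡t) i≡j) (combine-remQuot {2} k r′))

  byPosition : ∀ (Q : Fin (size G) → Set) → (∀ i b → Q (position i b)) → ∀ e → Q e
  byPosition Q Q-position e = let i , b , eq = covered e in subst Q eq (Q-position i b)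

  neighbour-of-middle : ∀ i {v} → Adj (middle i) v → ∃[ b ] v ≡ outer i b
  neighbour-of-middle i iv with neighbours-≡2 G degree-y (adj-sym adj-xy) adj-yz x≢z iv
    where open XYZPath (P i)
  ... | inj₁ v≡x = true , v≡x
  ... | inj₂ v≡z = false , v≡z

  -- A middle vertex has degree two, so every edge at it is an arm of its own path; disjointness
  -- then identifies the paths.
  middle-private : ∀ {i j d} → IsEndpoint (middle i) (arm j d) → i ≡ j
  middle-private {i} {j} {d} (inj₁ i≡outer)
    with b , eq ← neighbour-of-middle i (subst (λ v → Adj v (middle j)) (sym i≡outer) (arm-adj j d)) =
    arm-injectiveˡ {b = b} {d} (inj₂ (sym eq , i≡outer))
  middle-private {i} {j} {d} (inj₂ i≡j)
    with b , eq ← neighbour-of-middle i (subst (λ v → Adj v (outer j d)) (sym i≡j) (adj-sym (arm-adj j d))) =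
    arm-injectiveˡ {b = b} {d} (inj₁ (sym eq , i≡j))

  private
    potential = balanced⇒potential G sign-resp (noOddCycle⇒balanced ¬odd)
    pot       = proj₁ potential

  -- From `x` to `z` the potential changes exactly once: along `xy`, and not along `yz`, which is
  -- the first edge of no path.
  pot-ends : ∀ i → pot (outer i true) ≡ not (pot (outer i false))
  pot-ends i = trans
    (xor≡true⇒≡not _ _ (trans (proj₂ potential adj-xy) (sign-true ≐-refl)))
    (cong not (xor≡false⇒≡ _ _ (trans (proj₂ potential adj-yz) (sign-false yz-unsigned))))
    where
    open XYZPath (P i)
    yz-unsigned : ∀ j → ¬ (firstEdge j ≐ (y , z))
    yz-unsigned j eq =
      case proj₂ (arm-injective {j} {true} {i} {false} (≐-trans eq ≐-flip)) of λ ()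

  pot-outer : ∀ i b → pot (outer i (not b)) ≡ not (pot (outer i b))
  pot-outer i false = pot-ends i
  pot-outer i true  = trans (sym (not-involutive _)) (cong not (sym (pot-ends i)))

  colour : Fin (size G) → Bool
  colour e = let i , b , _ = covered e in pot (outer i b)

  partner : Fin (size G) → Fin (size G)
  partner e = let i , b , _ = covered e in position i (not b)

  -- `covered` picks indices of its own; injectivity of `position` shows that they are the given
  -- ones.
  colour-position : ∀ i b → colour (position i b) ≡ pot (outer i b)
  colour-position i b =
    let j , d , eq = covered (position i b)
        j≡i , d≡b  = position-injective {j} {d} {i} {b} eq
    in cong₂ (λ j d → pot (outer j d)) j≡i d≡b

  partner-position : ∀ i b → partner (position i b) ≡ position i (not b)
  partner-position i b =
    let j , d , eq = covered (position i b)
        j≡i , d≡b  = position-injective {j} {d} {i} {b} eq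
    in cong₂ (λ j d → position j (not d)) j≡i d≡b

  -- Since middle vertices are private, edges of different paths meet only in a common outer vertex,
  -- whose potential colours both alike.
  opposite-arms : ∀ {i b j d} → ShareEndpoint (arm i b) (arm j d) → pot (outer j d) ≢ pot (outer i b) →
                  i ≡ j × d ≡ not b
  opposite-arms {i} {b} {j} {d} (w , w∈i , w∈j) differ with i ≟ j
  ... | yes refl = refl , ¬-not (λ d≡b → differ (cong (pot ∘ outer i) d≡b))
  ... | no  i≢j with w∈i | w∈j
  ...   | inj₂ refl | _         = contradiction (middle-private {i} {j} {d} w∈j) i≢j
  ...   | inj₁ _    | inj₂ refl = contradiction (sym (middle-private {j} {i} {b} w∈i)) i≢j
  ...   | inj₁ refl | inj₁ eq   = contradiction (cong pot (sym eq)) differ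

  bivariegated : Bivariegated (lineGraph G)
  bivariegated = matching⇒bivariegated (lineGraph G) {k} colour partner size≡2k
    (byPosition (λ e → Adjᴸ e (partner e)) adj-partner)
    (byPosition (λ e → colour (partner e) ≡ not (colour e)) colour-partner)
    (λ e {f} → byPosition (λ e → ∀ f → Adjᴸ e f → colour f ≢ colour e → partner e ≡ f)
      (λ i b → byPosition _ (partner-unique i b)) e f)
    where
    open Graph (lineGraph G) using () renaming (Adj to Adjᴸ)
    adj-partner : ∀ i b → Adjᴸ (position i b) (partner (position i b))
    adj-partner i b = subst (Adjᴸ (position i b)) (sym (partner-position i b))
      ( (λ eq → not-¬ refl (proj₂ (position-injective {i} {b} {i} {not b} eq)))
      , middle i , endpoint-resp (position-≐ i b) (inj₂ refl) , endpoint-resp (position-≐ i (not b)) (inj₂ refl))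
    colour-partner : ∀ i b → colour (partner (position i b)) ≡ not (colour (position i b))
    colour-partner i b = begin
      colour (partner (position i b))  ≡⟨ cong colour (partner-position i b) ⟩
      colour (position i (not b))      ≡⟨ colour-position i (not b) ⟩
      pot (outer i (not b))            ≡⟨ pot-outer i b ⟩
      not (pot (outer i b))            ≡⟨ cong not (colour-position i b) ⟨
      not (colour (position i b))      ∎
      where open ≡-Reasoning
    partner-unique : ∀ i b j d → Adjᴸ (position i b) (position j d) →
                     colour (position j d) ≢ colour (position i b) → partner (position i b) ≡ position j d
    partner-unique i b j d (_ , w , w∈ , w∈′) differ =
      let i≡j , d≡not-b = opposite-arms {i} {b} {j} {d}
            (w , endpoint-resp (≐-sym (position-≐ i b)) w∈ , endpoint-resp (≐-sym (position-≐ j d)) w∈′)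
            (λ eq → differ (trans (colour-position j d) (trans eq (sym (colour-position i b)))))
      in trans (partner-position i b) (cong₂ position i≡j (sym d≡not-b))

-- From a bivariegation to a path system.

module Converse (G : Graph) (S : Subset (size G))
                (matched : ∀ v → v ∈ˢ S → ∃! _≡_ (λ w → w ∈ˢ ∁ S × Graph.Adj (lineGraph G) v w))
                (matched′ : ∀ v → v ∈ˢ ∁ S → ∃! _≡_ (λ w → w ∈ˢ S × Graph.Adj (lineGraph G) v w)) where

  open Graph G using (Adj; adj-sym; adj-irrefl; edges)
  open Graph (lineGraph G) using () renaming (Adj to Adjᴸ; adj-sym to adjᴸ-sym)

  partner : ∀ {v} → v ∈ˢ S → Fin (size G)
  partner v∈ = proj₁ (matched _ v∈)

  partner-∈ : ∀ {v} (v∈ : v ∈ˢ S) → partner v∈ ∈ˢ ∁ S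
  partner-∈ v∈ = proj₁ (proj₁ (proj₂ (matched _ v∈)))

  partner-adj : ∀ {v} (v∈ : v ∈ˢ S) → Adjᴸ v (partner v∈)
  partner-adj v∈ = proj₂ (proj₁ (proj₂ (matched _ v∈)))

  partner-unique : ∀ {v w} (v∈ : v ∈ˢ S) → w ∈ˢ ∁ S → Adjᴸ v w → partner v∈ ≡ w
  partner-unique v∈ w∈ vw = proj₂ (proj₂ (matched _ v∈)) (w∈ , vw)

  -- Uniqueness is applied from the other side: a vertex of `∁ S` has only one neighbour in `S`.
  partner-injective : ∀ {v v′} (v∈ : v ∈ˢ S) (v′∈ : v′ ∈ˢ S) → partner v∈ ≡ partner v′∈ → v ≡ v′
  partner-injective {v} {v′} v∈ v′∈ eq = trans (sym (unique (v∈ , adjᴸ-sym {v} (partner-adj v∈))))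
    (unique (v′∈ , adjᴸ-sym {v′} (subst (Adjᴸ v′) (sym eq) (partner-adj v′∈))))
    where unique = λ {w} → proj₂ (proj₂ (matched′ _ (partner-∈ v∈))) {w}

  -- Outside `S`, `f` would be a second match for `v`; inside `S`, a second match for `partner v∈`.
  -- A matched pair thus lies in no triangle of the line graph.
  no-common-neighbour : ∀ {v f} (v∈ : v ∈ˢ S) → Adjᴸ v f → ¬ Adjᴸ (partner v∈) f
  no-common-neighbour {v} {f} v∈ vf wf with f ∈? S
  ... | no  f∉ = proj₁ wf (partner-unique v∈ (x∉p⇒x∈∁p f∉) vf)
  ... | yes f∈ = proj₁ vf (trans (sym (unique (v∈ , adjᴸ-sym {v} (partner-adj v∈)))) (unique (f∈ , wf)))
    where unique = λ {w} → proj₂ (proj₂ (matched′ _ (partner-∈ v∈))) {w}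

  edge-adj : ∀ {a b k} → (a , b) ≐ lookup edges k → Adj a b
  edge-adj {k = k} ab≐ = adj-resp ab≐ (proj₂ (∈-edges⁻ G (∈-lookup k)))
    where
    adj-resp : ∀ {a b c d} → (a , b) ≐ (c , d) → Adj c d → Adj a b
    adj-resp (inj₁ (refl , refl)) cd = cd
    adj-resp (inj₂ (refl , refl)) cd = adj-sym cd

  touching : ∀ {a b c k l} → (a , b) ≐ lookup edges k → (a , c) ≐ lookup edges l → b ≢ c → Adjᴸ k l
  touching {a} {b} {c} {k} ab≐ ac≐ b≢c =
    (λ { refl → case ≐-trans ab≐ (≐-sym ac≐) of λ
           { (inj₁ (_ , b≡c)) → b≢c b≡c
           ; (inj₂ (_ , b≡a)) → adj-irrefl (sym b≡a) (edge-adj {k = k} ab≐) } }) ,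
    a , endpoint-resp ab≐ (inj₁ refl) , endpoint-resp ac≐ (inj₁ refl)

  -- The middle vertex is the endpoint shared by the matched edges. An edge `xz`, or a third edge at
  -- `y`, would meet both of them and be a common neighbour in the line graph; this gives
  -- inducedness and degree two alike.
  crossingPath : ∀ {v} (v∈ : v ∈ˢ S) → Σ[ p ∈ XYZPath G ] let open XYZPath p in
                 (x , y) ≐ lookup edges v × (y , z) ≐ lookup edges (partner v∈)
  crossingPath {v} v∈ = record
    { x = x ; y = y ; z = z
    ; x≢y      = λ x≡y → adj-irrefl x≡y adj-xy
    ; y≢z      = λ y≡z → adj-irrefl y≡z adj-yz
    ; x≢z      = x≢z
    ; adj-xy   = adj-xy
    ; adj-yz   = adj-yz
    ; induced  = λ xz → let f , xz≐ = adj⇒position G xz in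
        no-common-neighbour v∈ (touching {l = f} xy≐ xz≐ λ y≡z → adj-irrefl y≡z adj-yz)
          (touching {k = partner v∈} {f} zy≐ (≐-trans ≐-flip xz≐) λ y≡x → adj-irrefl (sym y≡x) adj-xy)
    ; degree-y = degree-≡2 G (adj-sym adj-xy) adj-yz x≢z only
    } , xy≐ , yz≐
    where
    y = proj₁ (proj₂ (partner-adj v∈))
    x = proj₁ (otherEndpoint (lookup edges v) (proj₁ (proj₂ (proj₂ (partner-adj v∈)))))
    z = proj₁ (otherEndpoint (lookup edges (partner v∈)) (proj₂ (proj₂ (proj₂ (partner-adj v∈)))))
    xy≐ : (x , y) ≐ lookup edges v
    xy≐ = proj₂ (otherEndpoint (lookup edges v) (proj₁ (proj₂ (proj₂ (partner-adj v∈)))))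
    zy≐ : (z , y) ≐ lookup edges (partner v∈)
    zy≐ = proj₂ (otherEndpoint (lookup edges (partner v∈)) (proj₂ (proj₂ (proj₂ (partner-adj v∈)))))
    yz≐ : (y , z) ≐ lookup edges (partner v∈)
    yz≐ = ≐-trans ≐-flip zy≐
    adj-xy : Adj x y
    adj-xy = edge-adj {k = v} xy≐
    adj-yz : Adj y z
    adj-yz = edge-adj {k = partner v∈} yz≐
    x≢z : x ≢ z
    -- Equal outer ends would make the two matched edges coincide.
    x≢z x≡z = proj₁ (partner-adj v∈)
      (position-unique G (≐-trans (≐-sym xy≐) (subst (λ u → (u , y) ≐ lookup edges (partner v∈)) (sym x≡z) zy≐)))
    only : ∀ {t} → Adj y t → t ≡ x ⊎ t ≡ z
    only {t} yt with t ≟ x | t ≟ z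
    ... | yes t≡x | _       = inj₁ t≡x
    ... | no  _   | yes t≡z = inj₂ t≡z
    ... | no  t≢x | no  t≢z = let f , yt≐ = adj⇒position G yt in contradiction
      (touching {k = partner v∈} {f} yz≐ yt≐ (t≢z ∘ sym))
      (no-common-neighbour v∈ (touching {k = v} {f} (≐-trans ≐-flip xy≐) yt≐ (t≢x ∘ sym)))

  P : Fin ∣ S ∣ → XYZPath G
  P i = proj₁ (crossingPath (element-∈ S i))

  first≐ : ∀ i → let open XYZPath (P i) in (x , y) ≐ lookup edges (element S i)
  first≐ i = proj₁ (proj₂ (crossingPath (element-∈ S i)))

  second≐ : ∀ i → let open XYZPath (P i) in (y , z) ≐ lookup edges (partner (element-∈ S i))
  second≐ i = proj₂ (proj₂ (crossingPath (element-∈ S i)))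

  element≢partner : ∀ i j → element S i ≢ partner (element-∈ S j)
  element≢partner i j eq = x∈∁p⇒x∉p (partner-∈ (element-∈ S j)) (subst (_∈ˢ S) eq (element-∈ S i))

  disjoint : ∀ i j → i ≢ j → Disjoint (P i) (P j)
  disjoint i j i≢j (e , e∈i , e∈j) with positions e∈i | positions e∈j
    where
    positions : ∀ {i} → e ∈ᵉ pathEdges (P i) →
                e ≐ lookup edges (element S i) ⊎ e ≐ lookup edges (partner (element-∈ S i))
    positions {i} (here e≐)         = inj₁ (≐-trans e≐ (first≐ i))
    positions {i} (there (here e≐)) = inj₂ (≐-trans e≐ (second≐ i))
  ... | inj₁ p | inj₁ q = i≢j (element-injective S (position-unique G (≐-trans (≐-sym p) q)))
  ... | inj₁ p | inj₂ q = element≢partner i j (position-unique G (≐-trans (≐-sym p) q))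
  ... | inj₂ p | inj₁ q = element≢partner j i (position-unique G (≐-trans (≐-sym q) p))
  ... | inj₂ p | inj₂ q = i≢j (element-injective S
    (partner-injective (element-∈ S i) (element-∈ S j) (position-unique G (≐-trans (≐-sym p) q))))

  open PathSystem P disjoint

  Touched : Vertex G → Set
  Touched u = ∃[ k ] k ∈ˢ ∁ S × IsEndpoint u (lookup edges k)

  touched? : ∀ u → Dec (Touched u)
  touched? u = any? λ k → (k ∈? ∁ S) ×-dec isEndpoint? u (lookup edges k)

  pot : Vertex G → Bool
  pot u = does (touched? u)

  y-touched : ∀ i → Touched (XYZPath.y (P i))
  y-touched i = partner (element-∈ S i) , partner-∈ (element-∈ S i) , endpoint-resp (second≐ i) (inj₁ refl)

  -- An edge outside `S` at `x` is adjacent to `xy`, hence is its partner `yz`, which misses `x`.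
  x-untouched : ∀ i → ¬ Touched (XYZPath.x (P i))
  x-untouched i (l , l∈ , x∈l) = case endpoint-resp (≐-sym second≐l) x∈l of λ
    { (inj₁ x≡y) → x≢y x≡y ; (inj₂ x≡z) → x≢z x≡z }
    where
    open XYZPath (P i)
    partner≡l : partner (element-∈ S i) ≡ l
    partner≡l = partner-unique (element-∈ S i) l∈
      ( (λ eq → x∈∁p⇒x∉p l∈ (subst (_∈ˢ S) eq (element-∈ S i)))
      , x , endpoint-resp (first≐ i) (inj₁ refl) , x∈l)
    second≐l : (y , z) ≐ lookup edges l
    second≐l = subst (λ k → (y , z) ≐ lookup edges k) partner≡l (second≐ i)

  pot-resp : ∀ {a b c d} → (a , b) ≐ (c , d) → pot a xor pot b ≡ pot c xor pot d
  pot-resp (inj₁ (refl , refl))         = refl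
  pot-resp {a} {b} (inj₂ (refl , refl)) = xor-comm (pot a) (pot b)

  -- An edge outside `S` has both ends touched, and sign 0 because first edges lie in `S`. An edge
  -- of `S` is the first edge `xy` of its path, with `y` touched and `x` not, and has sign 1.
  pot-isPotential : IsPotential G sign pot
  pot-isPotential {a} {b} ab with adj⇒position G ab
  ... | k , ab≐ with k ∈? S
  ...   | no  k∉ = trans
    (cong₂ _xor_ (dec-true (touched? a) (k , x∉p⇒x∈∁p k∉ , endpoint-resp ab≐ (inj₁ refl)))
                 (dec-true (touched? b) (k , x∉p⇒x∈∁p k∉ , endpoint-resp ab≐ (inj₂ refl))))
    (sym (sign-false λ i i≐ab → k∉
      (subst (_∈ˢ S) (position-unique G (≐-trans (≐-sym (first≐ i)) (≐-trans i≐ab ab≐))) (element-∈ S i))))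
  ...   | yes k∈ with element-surjective S k∈
  ...     | i , refl = let i≐ab = ≐-trans (first≐ i) (≐-sym ab≐) in trans (sym (pot-resp i≐ab)) (trans
    (cong₂ _xor_ (dec-false (touched? _) (x-untouched i)) (dec-true (touched? _) (y-touched i)))
    (sym (sign-true i≐ab)))

  hasPathSystem : HasPathSystem G ∣ S ∣
  hasPathSystem = P , disjoint , balanced⇒noOddCycle (potential⇒balanced G {pot = pot} pot-isPotential)

theorem1p1 : (G : Graph) →
    (2 ∣ size G → HasPathSystem G (size G / 2) → Bivariegated (lineGraph G)) ×
    ((n : ℕ) → Bivariegated (lineGraph G) → order (lineGraph G) ≡ 2 * n → HasPathSystem G n)
theorem1p1 G = sufficiency , converse
  where
  sufficiency : 2 ∣ size G → HasPathSystem G (size G / 2) → Bivariegated (lineGraph G)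
  sufficiency 2∣q (P , disjoint , ¬odd) =
    Sufficiency.bivariegated G (sym (m*[n/m]≡n 2∣q)) P disjoint ¬odd
  converse : ∀ n → Bivariegated (lineGraph G) → order (lineGraph G) ≡ 2 * n → HasPathSystem G n
  converse n (m , order≡2m , S , ∣S∣≡m , _ , matched , matched′) order≡2n =
    -- Both `m` and `n` are half the order of the line graph.
    subst (HasPathSystem G) (trans ∣S∣≡m (*-cancelˡ-≡ m n 2 (trans (sym order≡2m) order≡2n)))
      (Converse.hasPathSystem G S matched matched′)
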